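{- (1) Every instance of the schemes $\curlyvee_\Box$ and $\curlyvee_\Diamond$ is provable in $\mathcal{H}\mathsf{CN4K}^\pm\oplus\{\Join_\Box,\Join_\Diamond\}$, and every instance of the schemes $\pm_\Box$ and $\pm_\Diamond$ is provable in $\mathcal{H}\mathsf{CN4K}^\curlyvee\oplus\{\Join_\Box,\Join_\Diamond\}$. (2) In the calculus $\mathcal{H}\mathsf{CN4K}\oplus\{\pm_\Box,\pm_\Diamond,\curlyvee_\Box,\curlyvee_\Diamond\}$, for a propositional variable $p$, neither $\Box p\leftrightarrow{\sim}\Diamond{\sim}p$ (an instance of $\Join_\Box$) nor $\Diamond p\leftrightarrow{\sim}\Box{\sim}p$ (an instance of $\Join_\Diamond$) is provable.
   Context: Fix a countable set $\mathsf{Prop}$ of propositional variables. The language $\mathcal{L}$ is given by the grammar $\phi::=p\mid{\sim}\phi\mid(\phi\wedge\phi)\mid(\phi\vee\phi)\mid(\phi\to\phi)\mid\Box\phi\mid\Diamond\phi$ with $p\in\mathsf{Prop}$. $\phi\leftrightarrow\chi$ abbreviates $(\phi\to\chi)\wedge(\chi\to\phi)$. $\mathcal{H}\mathsf{N4}$ has as axioms all $\mathcal{L}$-instances of: $\phi\to(\chi\to\phi)$; $(\phi\to(\chi\to\psi))\to((\phi\to\chi)\to(\phi\to\psi))$; $\phi\wedge\chi\to\phi$; $\phi\wedge\chi\to\chi$; $\phi\to(\chi\to\phi\wedge\chi)$; $\phi\to\phi\vee\chi$; $\chi\to\phi\vee\chi$; $(\phi\to\psi)\to((\chi\to\psi)\to(\phi\vee\chi\to\psi))$;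 ${\sim}{\sim}\phi\leftrightarrow\phi$; ${\sim}(\phi\wedge\chi)\leftrightarrow({\sim}\phi\vee{\sim}\chi)$; ${\sim}(\phi\vee\chi)\leftrightarrow({\sim}\phi\wedge{\sim}\chi)$; ${\sim}(\phi\to\chi)\leftrightarrow(\phi\wedge{\sim}\chi)$; and modus ponens. Further schemes: $\top_\Box$: $\Box(\phi\to\phi)$; $\top_\Diamond$: ${\sim}\Diamond{\sim}(\phi\to\phi)$; $\wedge_\Box$: $(\Box\phi\wedge\Box\chi)\to\Box(\phi\wedge\chi)$; $\wedge_\Diamond$: $({\sim}\Diamond\phi\wedge{\sim}\Diamond\chi)\to{\sim}\Diamond(\phi\vee\chi)$; $\pm_\Box$: $\Box(\phi\to\chi)\to(\Diamond\phi\to\Diamond\chi)$; $\pm_\Diamond$: ${\sim}\Diamond{\sim}({\sim}\phi\to{\sim}\chi)\to({\sim}\Box\phi\to{\sim}\Box\chi)$; $\curlyvee_\Box$: $\Box(\phi\to\chi)\to({\sim}\Box{\sim}\phi\to{\sim}\Box{\sim}\chi)$; $\curlyvee_\Diamond$: ${\sim}\Diamond{\sim}(\phi\to\chi)\to(\Diamond\phi\to\Diamond\chi)$; $\Join_\Box$: $\Box\phi\leftrightarrow{\sim}\Diamond{\sim}\phi$; $\Join_\Diamond$: $\Diamond\phi\leftrightarrow{\sim}\Box{\sim}\phi$. Rules: from $\vdash\phi\to\chi$ infer $\vdash\Box\phi\to\Box\chi$; from $\vdash\phi\to\chi$ infer $\vdash\Diamond\phi\to\Diamond\chi$; from $\vdash{\sim}\phi\to{\sim}\chi$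 infer $\vdash{\sim}\Box\phi\to{\sim}\Box\chi$; from $\vdash{\sim}\phi\to{\sim}\chi$ infer $\vdash{\sim}\Diamond\phi\to{\sim}\Diamond\chi$. $\mathcal{H}\mathsf{CN4K}=\mathcal{H}\mathsf{N4}$ plus $\top_\Box,\wedge_\Box,\top_\Diamond,\wedge_\Diamond$ and the four modal rules. $\mathcal{C}\oplus\mathbf{R}$ denotes calculus $\mathcal{C}$ extended with the axiom schemes/rules in $\mathbf{R}$; $\mathcal{H}\mathsf{CN4K}^\pm=\mathcal{H}\mathsf{CN4K}\oplus\{\pm_\Box,\pm_\Diamond\}$, $\mathcal{H}\mathsf{CN4K}^\curlyvee=\mathcal{H}\mathsf{CN4K}\oplus\{\curlyvee_\Box,\curlyvee_\Diamond\}$. A formula is provable if it is the last element of a finite sequence of axiom instances and rule consequences of earlier elements. -}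

module Defs where

open import Data.List.Base using (List; []; _∷_)
open import Data.List.Membership.Propositional using (_∈_)
open import Data.List.Relation.Unary.All using (All)
open import Data.Product.Base using (∃-syntax)
open import Level using (0ℓ)
open import Relation.Binary.Core using (REL)
open import Relation.Unary using (Pred; _∪_)

module Language (Var : Set) where

  infix  9 ∼_ □_ ◇_
  infixr 8 _∧_
  infixr 7 _∨_
  infixr 6 _⇒_
  infix  5 _⇔_

  data Formula : Set where
    var     : Var → Formula
    ∼_      : Formula → Formula
    _∧_     : Formula → Formula → Formula
    _∨_     : Formula → Formula → Formula
    _⇒_     : Formula → Formula → Formula
    □_      : Formula → Formula
    ◇_      : Formula → Formula

  _⇔_ : Formula → Formula → Formula
  φ ⇔ χ = (φ ⇒ χ) ∧ (χ ⇒ φ)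

  -- A scheme is the set of its instances.
  Scheme : Set₁
  Scheme = Pred Formula 0ℓ

  -- A rule relates a list of premises to a conclusion.
  Rule : Set₁
  Rule = REL (List Formula) Formula 0ℓ

  record Calculus : Set₁ where
    field
      Axiom     : Scheme
      Inference : Rule

  open Calculus public

  infixl 4 _⊕_

  _⊕_ : Calculus → Scheme → Calculus
  C ⊕ S = record { Axiom = Axiom C ∪ S ; Inference = Inference C }

  -- Sequences are listed with the most recent element first, so in φ ∷ φs
  -- the earlier elements are those of φs, and φ is the last one.
  data IsProof (C : Calculus) : List Formula → Set where
    []        : IsProof C []
    axiom     : ∀ {φ φs} → Axiom C φ →
                IsProof C φs → IsProof C (φ ∷ φs)
    inference : ∀ {Γ φ φs} → Inference C Γ φ → All (_∈ φs) Γ →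
                IsProof C φs → IsProof C (φ ∷ φs)

  infix 3 _⊢_

  _⊢_ : Calculus → Formula → Set
  C ⊢ φ = ∃[ φs ] IsProof C (φ ∷ φs)

  data N4Axiom : Scheme where
    K    : ∀ φ χ → N4Axiom (φ ⇒ χ ⇒ φ)
    S    : ∀ φ χ ψ → N4Axiom ((φ ⇒ χ ⇒ ψ) ⇒ (φ ⇒ χ) ⇒ φ ⇒ ψ)
    ∧-e₁ : ∀ φ χ → N4Axiom (φ ∧ χ ⇒ φ)
    ∧-e₂ : ∀ φ χ → N4Axiom (φ ∧ χ ⇒ χ)
    ∧-i  : ∀ φ χ → N4Axiom (φ ⇒ χ ⇒ φ ∧ χ)
    ∨-i₁ : ∀ φ χ → N4Axiom (φ ⇒ φ ∨ χ)
    ∨-i₂ : ∀ φ χ → N4Axiom (χ ⇒ φ ∨ χ)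
    ∨-e  : ∀ φ χ ψ → N4Axiom ((φ ⇒ ψ) ⇒ (χ ⇒ ψ) ⇒ φ ∨ χ ⇒ ψ)
    ∼∼   : ∀ φ → N4Axiom (∼ ∼ φ ⇔ φ)
    ∼∧   : ∀ φ χ → N4Axiom (∼ (φ ∧ χ) ⇔ ∼ φ ∨ ∼ χ)
    ∼∨   : ∀ φ χ → N4Axiom (∼ (φ ∨ χ) ⇔ ∼ φ ∧ ∼ χ)
    ∼⇒   : ∀ φ χ → N4Axiom (∼ (φ ⇒ χ) ⇔ φ ∧ ∼ χ)

  data ModusPonens : Rule where
    mp : ∀ φ χ → ModusPonens (φ ∷ (φ ⇒ χ) ∷ []) χ

  data ⊤□ : Scheme where
    inst : ∀ φ → ⊤□ (□ (φ ⇒ φ))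

  data ⊤◇ : Scheme where
    inst : ∀ φ → ⊤◇ (∼ ◇ ∼ (φ ⇒ φ))

  data ∧□ : Scheme where
    inst : ∀ φ χ → ∧□ (□ φ ∧ □ χ ⇒ □ (φ ∧ χ))

  data ∧◇ : Scheme where
    inst : ∀ φ χ → ∧◇ (∼ ◇ φ ∧ ∼ ◇ χ ⇒ ∼ ◇ (φ ∨ χ))

  data ±□ : Scheme where
    inst : ∀ φ χ → ±□ (□ (φ ⇒ χ) ⇒ ◇ φ ⇒ ◇ χ)

  data ±◇ : Scheme where
    inst : ∀ φ χ → ±◇ (∼ ◇ ∼ (∼ φ ⇒ ∼ χ) ⇒ ∼ □ φ ⇒ ∼ □ χ)

  data ⋎□ : Scheme where
    inst : ∀ φ χ → ⋎□ (□ (φ ⇒ χ) ⇒ ∼ □ ∼ φ ⇒ ∼ □ ∼ χ)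

  data ⋎◇ : Scheme where
    inst : ∀ φ χ → ⋎◇ (∼ ◇ ∼ (φ ⇒ χ) ⇒ ◇ φ ⇒ ◇ χ)

  data ⋈□ : Scheme where
    inst : ∀ φ → ⋈□ (□ φ ⇔ ∼ ◇ ∼ φ)

  data ⋈◇ : Scheme where
    inst : ∀ φ → ⋈◇ (◇ φ ⇔ ∼ □ ∼ φ)

  data N4KInference : Rule where
    modusPonens : ∀ {Γ φ} → ModusPonens Γ φ → N4KInference Γ φ
    □-mono      : ∀ φ χ → N4KInference ((φ ⇒ χ) ∷ []) (□ φ ⇒ □ χ)
    ◇-mono      : ∀ φ χ → N4KInference ((φ ⇒ χ) ∷ []) (◇ φ ⇒ ◇ χ)
    ∼□-mono     : ∀ φ χ → N4KInference ((∼ φ ⇒ ∼ χ) ∷ []) (∼ □ φ ⇒ ∼ □ χ)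
    ∼◇-mono     : ∀ φ χ → N4KInference ((∼ φ ⇒ ∼ χ) ∷ []) (∼ ◇ φ ⇒ ∼ ◇ χ)

  HN4 : Calculus
  HN4 = record { Axiom = N4Axiom ; Inference = ModusPonens }

  HCN4K : Calculus
  HCN4K = record
    { Axiom     = Axiom HN4 ∪ ⊤□ ∪ ∧□ ∪ ⊤◇ ∪ ∧◇
    ; Inference = N4KInference
    }

  HCN4K± : Calculus
  HCN4K± = HCN4K ⊕ (±□ ∪ ±◇)

  HCN4K⋎ : Calculus
  HCN4K⋎ = HCN4K ⊕ (⋎□ ∪ ⋎◇)

{-# OPTIONS --safe #-}
-- Given ⋈□ and ⋈◇, the ± and ⋎ schemes arise from one another by replacing the
-- antecedents and the consequent with equivalents; only for ±◇ do the double
-- negations in ∼ □ ∼ ∼ φ have to be removed, by ∼□-mono.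
--
-- For the unprovability, verification and falsification are interpreted
-- separately in one world: □ φ is verified when φ is and always falsified, ◇ φ is
-- never verified and always falsified. As ∼ □ and ∼ ◇ are constantly true and ◇
-- is constantly false, the ± and ⋎ schemes hold trivially, whereas a variable that
-- is not verified refutes both ∼ ◇ ∼ p ⇒ □ p and ∼ □ ∼ p ⇒ ◇ p.
module Submission where

open import Defs
open import Data.Empty using (⊥)
open import Data.List.Base using ([]; _∷_; _++_)
open import Data.List.Membership.Propositional using (_∈_)
open import Data.List.Membership.Propositional.Properties using (∈-++⁺ˡ; ∈-++⁺ʳ)
open import Data.List.Relation.Unary.All as All using (All; []; _∷_)
open import Data.List.Relation.Unary.Any using (here)
open import Data.Nat.Base using (ℕ)
open import Data.Product.Base using (_×_; _,_; proj₁; proj₂; ∃-syntax)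
open import Data.Sum.Base using (_⊎_; inj₁; inj₂; [_,_])
open import Data.Unit.Base using (⊤; tt)
open import Function.Base using (id; _∘_)
open import Function.Bundles using (_↣_)
open import Relation.Binary.PropositionalEquality.Core using (refl)
open import Relation.Nullary.Negation.Core using (¬_)
open import Relation.Unary using (_∪_; _⊆_)

module _ {Var : Set} where
  open Language Var

  module _ {C : Calculus} where

    ++-isProof : ∀ {φs ψs} → IsProof C φs → IsProof C ψs → IsProof C (φs ++ ψs)
    ++-isProof []                 q = q
    ++-isProof (axiom a p)        q = axiom a (++-isProof p q)
    ++-isProof (inference r ∈s p) q =
      inference r (All.map ∈-++⁺ˡ ∈s) (++-isProof p q)

    ⊢-axiom : Axiom C ⊆ (C ⊢_)
    ⊢-axiom a = [] , axiom a []

    -- A proof is one sequence, not a tree, so the separate proofs of the premises must be joined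
    -- before a rule can cite them.
    merge : ∀ {Γ} → All (C ⊢_) Γ → ∃[ φs ] (IsProof C φs × All (_∈ φs) Γ)
    merge []                   = [] , [] , []
    merge {φ ∷ Γ} ((φs , p) ∷ ps) with ψs , q , ∈s ← merge ps =
      φ ∷ φs ++ ψs , ++-isProof p q ,
      here refl ∷ All.map (∈-++⁺ʳ (φ ∷ φs)) ∈s

    ⊢-inference : ∀ {Γ φ} → Inference C Γ φ → All (C ⊢_) Γ → C ⊢ φ
    ⊢-inference r ps with φs , p , ∈s ← merge ps = φs , inference r ∈s p

  module HN4-Reasoning
    {C : Calculus}
    (N4⊆C : N4Axiom ⊆ Axiom C)
    (MP⊆C : ∀ {Γ φ} → ModusPonens Γ φ → Inference C Γ φ)
    where

    infixl 5 _·_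

    n4 : N4Axiom ⊆ (C ⊢_)
    n4 a = ⊢-axiom (N4⊆C a)

    _·_ : ∀ {φ χ} → C ⊢ φ ⇒ χ → C ⊢ φ → C ⊢ χ
    f · x = ⊢-inference (MP⊆C (mp _ _)) (x ∷ f ∷ [])

    weaken : ∀ {φ χ} → C ⊢ χ → C ⊢ φ ⇒ χ
    weaken x = n4 (K _ _) · x

    ⇒-trans : ∀ {φ χ ψ} → C ⊢ φ ⇒ χ → C ⊢ χ ⇒ ψ → C ⊢ φ ⇒ ψ
    ⇒-trans f g = n4 (S _ _ _) · weaken g · f

    ⇒-monoʳ : ∀ {φ χ ψ} → C ⊢ χ ⇒ ψ → C ⊢ (φ ⇒ χ) ⇒ φ ⇒ ψ
    ⇒-monoʳ g = n4 (S _ _ _) · weaken g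

    ⇒-antiˡ : ∀ {φ χ ψ} → C ⊢ φ ⇒ χ → C ⊢ (χ ⇒ ψ) ⇒ φ ⇒ ψ
    -- `K` followed by `S` gives `(χ ⇒ ψ) ⇒ (φ ⇒ χ) ⇒ φ ⇒ ψ`; the outer `S` then discharges its
    -- second antecedent with `f`.
    ⇒-antiˡ f = n4 (S _ _ _) · ⇒-trans (n4 (K _ _)) (n4 (S _ _ _)) · weaken f

    ⇒-refl : ∀ {φ} → C ⊢ φ ⇒ φ
    ⇒-refl {φ} = n4 (S _ _ _) · n4 (K _ (φ ⇒ φ)) · n4 (K _ _)

    ⇒-replace : ∀ {φ φ′ χ χ′ ψ ψ′} →
                C ⊢ φ′ ⇒ φ → C ⊢ χ′ ⇒ χ → C ⊢ ψ ⇒ ψ′ →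
                C ⊢ φ ⇒ χ ⇒ ψ → C ⊢ φ′ ⇒ χ′ ⇒ ψ′
    ⇒-replace f g h x = ⇒-trans f (⇒-trans x (⇒-trans (⇒-antiˡ g) (⇒-monoʳ h)))

    ⇔-to : ∀ {φ χ} → C ⊢ φ ⇔ χ → C ⊢ φ ⇒ χ
    ⇔-to e = n4 (∧-e₁ _ _) · e

    ⇔-from : ∀ {φ χ} → C ⊢ φ ⇔ χ → C ⊢ χ ⇒ φ
    ⇔-from e = n4 (∧-e₂ _ _) · e

  -- With `R` left open, the same derivations serve both directions; `C` unfolds to each of the two
  -- calculi.
  module HCN4K⊕⋈ (R : Scheme) where

    C : Calculus
    C = HCN4K ⊕ R ⊕ (⋈□ ∪ ⋈◇)

    open HN4-Reasoning {C} (inj₁ ∘ inj₁ ∘ inj₁) modusPonens public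

    extra : R ⊆ (C ⊢_)
    extra r = ⊢-axiom (inj₁ (inj₂ r))

    □⇔∼◇∼ : ∀ φ → C ⊢ □ φ ⇔ ∼ ◇ ∼ φ
    □⇔∼◇∼ φ = ⊢-axiom (inj₂ (inj₁ (inst φ)))

    ◇⇔∼□∼ : ∀ φ → C ⊢ ◇ φ ⇔ ∼ □ ∼ φ
    ◇⇔∼□∼ φ = ⊢-axiom (inj₂ (inj₂ (inst φ)))

    -- The premise of `∼□-mono` compares negated formulas, so double negation is taken at `∼ φ`
    -- rather than at `φ`.
    ∼□⇒∼□∼∼ : ∀ φ → C ⊢ ∼ □ φ ⇒ ∼ □ ∼ ∼ φ
    ∼□⇒∼□∼∼ φ = ⊢-inference (∼□-mono φ (∼ ∼ φ)) (⇔-from (n4 (∼∼ (∼ φ))) ∷ [])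

    ∼□∼∼⇒∼□ : ∀ φ → C ⊢ ∼ □ ∼ ∼ φ ⇒ ∼ □ φ
    ∼□∼∼⇒∼□ φ = ⊢-inference (∼□-mono (∼ ∼ φ) φ) (⇔-to (n4 (∼∼ (∼ φ))) ∷ [])

  ±⊢⋎□ : ⋎□ ⊆ (HCN4K± ⊕ (⋈□ ∪ ⋈◇) ⊢_)
  ±⊢⋎□ (inst φ χ) =
    ⇒-replace ⇒-refl (⇔-from (◇⇔∼□∼ φ)) (⇔-to (◇⇔∼□∼ χ)) (extra (inj₁ (inst φ χ)))
    where open HCN4K⊕⋈ (±□ ∪ ±◇)

  ±⊢⋎◇ : ⋎◇ ⊆ (HCN4K± ⊕ (⋈□ ∪ ⋈◇) ⊢_)
  ±⊢⋎◇ (inst φ χ) =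
    -- `±□` and `⋎◇` share the part `◇ φ ⇒ ◇ χ`, so only the first antecedent changes.
    ⇒-trans (⇔-from (□⇔∼◇∼ (φ ⇒ χ))) (extra (inj₁ (inst φ χ)))
    where open HCN4K⊕⋈ (±□ ∪ ±◇)

  ⋎⊢±□ : ±□ ⊆ (HCN4K⋎ ⊕ (⋈□ ∪ ⋈◇) ⊢_)
  ⋎⊢±□ (inst φ χ) =
    ⇒-trans (⇔-to (□⇔∼◇∼ (φ ⇒ χ))) (extra (inj₂ (inst φ χ)))
    where open HCN4K⊕⋈ (⋎□ ∪ ⋎◇)

  ⋎⊢±◇ : ±◇ ⊆ (HCN4K⋎ ⊕ (⋈□ ∪ ⋈◇) ⊢_)
  ⋎⊢±◇ (inst φ χ) =
    ⇒-replace (⇔-from (□⇔∼◇∼ (∼ φ ⇒ ∼ χ))) (∼□⇒∼□∼∼ φ) (∼□∼∼⇒∼□ χ)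
      -- Taking `⋎□` at negated formulas yields the antecedent `□ (∼ φ ⇒ ∼ χ)`.
      (extra (inj₁ (inst (∼ φ) (∼ χ))))
    where open HCN4K⊕⋈ (⋎□ ∪ ⋎◇)

  infix 3 ⊨⁺_ ⊨⁻_

  -- Nelson's clauses for the connectives, with types as truth values. Leaving every variable
  -- without either value lets a single model refute the equivalences for all `p`.
  mutual

    ⊨⁺_ : Formula → Set
    ⊨⁺ var _ = ⊥
    ⊨⁺ ∼ φ   = ⊨⁻ φ
    ⊨⁺ φ ∧ χ = (⊨⁺ φ) × (⊨⁺ χ)
    ⊨⁺ φ ∨ χ = (⊨⁺ φ) ⊎ (⊨⁺ χ)
    ⊨⁺ φ ⇒ χ = ⊨⁺ φ → ⊨⁺ χ
    ⊨⁺ □ φ   = ⊨⁺ φ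
    ⊨⁺ ◇ _   = ⊥

    ⊨⁻_ : Formula → Set
    ⊨⁻ var _ = ⊥
    ⊨⁻ ∼ φ   = ⊨⁺ φ
    ⊨⁻ φ ∧ χ = (⊨⁻ φ) ⊎ (⊨⁻ χ)
    ⊨⁻ φ ∨ χ = (⊨⁻ φ) × (⊨⁻ χ)
    ⊨⁻ φ ⇒ χ = (⊨⁺ φ) × (⊨⁻ χ)
    ⊨⁻ □ _   = ⊤
    ⊨⁻ ◇ _   = ⊤

  N4Axiom-valid : N4Axiom ⊆ ⊨⁺_
  N4Axiom-valid (K _ _)     = λ x _ → x
  N4Axiom-valid (S _ _ _)   = λ f g x → f x (g x)
  N4Axiom-valid (∧-e₁ _ _)  = proj₁
  N4Axiom-valid (∧-e₂ _ _)  = proj₂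
  N4Axiom-valid (∧-i _ _)   = _,_
  N4Axiom-valid (∨-i₁ _ _)  = inj₁
  N4Axiom-valid (∨-i₂ _ _)  = inj₂
  N4Axiom-valid (∨-e _ _ _) = [_,_]
  -- In the four negation axioms both sides of the equivalence unfold to the same type.
  N4Axiom-valid (∼∼ _)      = id , id
  N4Axiom-valid (∼∧ _ _)    = id , id
  N4Axiom-valid (∼∨ _ _)    = id , id
  N4Axiom-valid (∼⇒ _ _)    = id , id

  HCN4K-valid : Axiom HCN4K ⊆ ⊨⁺_
  HCN4K-valid (inj₁ a)                               = N4Axiom-valid a
  HCN4K-valid (inj₂ (inj₁ (inst _)))                 = id
  HCN4K-valid (inj₂ (inj₂ (inj₁ (inst _ _))))        = id
  HCN4K-valid (inj₂ (inj₂ (inj₂ (inj₁ (inst _)))))   = tt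
  HCN4K-valid (inj₂ (inj₂ (inj₂ (inj₂ (inst _ _))))) = λ _ → tt

  ±⋎-valid : ±□ ∪ ±◇ ∪ ⋎□ ∪ ⋎◇ ⊆ ⊨⁺_
  ±⋎-valid (inj₁ (inst _ _))               = λ _ → id
  ±⋎-valid (inj₂ (inj₁ (inst _ _)))        = λ _ → id
  ±⋎-valid (inj₂ (inj₂ (inj₁ (inst _ _)))) = λ _ → id
  ±⋎-valid (inj₂ (inj₂ (inj₂ (inst _ _)))) = λ _ → id

  N4KInference-sound : ∀ {Γ φ} → N4KInference Γ φ → All ⊨⁺_ Γ → ⊨⁺ φ
  N4KInference-sound (modusPonens (mp _ _)) (x ∷ f ∷ []) = f x
  N4KInference-sound (□-mono _ _)           (f ∷ [])     = f
  N4KInference-sound (◇-mono _ _)           _            = id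
  N4KInference-sound (∼□-mono _ _)          _            = id
  N4KInference-sound (∼◇-mono _ _)          _            = id

  -- Validity of the whole sequence is the induction hypothesis, since a rule may cite any earlier
  -- element.
  isProof⇒valid : ∀ {R} → R ⊆ ⊨⁺_ → ∀ {φs} → IsProof (HCN4K ⊕ R) φs → All ⊨⁺_ φs
  isProof⇒valid R-valid []                 = []
  isProof⇒valid R-valid (axiom a p)        =
    [ HCN4K-valid , R-valid ] a ∷ isProof⇒valid R-valid p
  isProof⇒valid R-valid (inference r ∈s p) with vs ← isProof⇒valid R-valid p =
    N4KInference-sound r (All.map (All.lookup vs) ∈s) ∷ vs

  ±⋎-sound : (HCN4K ⊕ (±□ ∪ ±◇ ∪ ⋎□ ∪ ⋎◇) ⊢_) ⊆ ⊨⁺_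
  ±⋎-sound (_ , p) = All.head (isProof⇒valid ±⋎-valid p)

theorem3 : (Var : Set) → Var ↣ ℕ → let open Language Var in
    ( (⋎□ ⊆ (HCN4K± ⊕ (⋈□ ∪ ⋈◇) ⊢_)) × (⋎◇ ⊆ (HCN4K± ⊕ (⋈□ ∪ ⋈◇) ⊢_))
    × (±□ ⊆ (HCN4K⋎ ⊕ (⋈□ ∪ ⋈◇) ⊢_)) × (±◇ ⊆ (HCN4K⋎ ⊕ (⋈□ ∪ ⋈◇) ⊢_)) )
    × (∀ (p : Var) →
    ¬ (HCN4K ⊕ (±□ ∪ ±◇ ∪ ⋎□ ∪ ⋎◇) ⊢ □ var p ⇔ ∼ ◇ ∼ var p)
    × ¬ (HCN4K ⊕ (±□ ∪ ±◇ ∪ ⋎□ ∪ ⋎◇) ⊢ ◇ var p ⇔ ∼ □ ∼ var p))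
theorem3 Var _ =
  (±⊢⋎□ , ±⊢⋎◇ , ⋎⊢±□ , ⋎⊢±◇) ,
  -- Both equivalences unfold to `(⊥ → ⊤) × (⊤ → ⊥)`.
  λ p → (λ d → proj₂ (±⋎-sound d) tt) , (λ d → proj₂ (±⋎-sound d) tt)
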